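{- Let $M$ be a local doxastic Kripke model and let $\mathfrak{H}(M)$ be the hypergraph model associated with $M$. (1) If $M$ belongs to the class $\mathcal{K}_n^{te}$ of local and proper doxastic Kripke models that are transitive and Euclidean, then $\mathfrak{H}(M)$ belongs to the class $\mathcal{H}_n^{su}$ of simple and $n$-uniform hypergraph models. (2) If $M$ belongs to the class $\mathcal{K}_n^{ste}$ of local and proper doxastic Kripke models that are serial, transitive and Euclidean, then $\mathfrak{H}(M)$ belongs to the class $\mathcal{H}_n^{sut}$ of simple, $n$-uniform and tail-complete hypergraph models.
   Context: Fix a set $\mathcal{A}$ of $n\geq 1$ agents (finite, $|\mathcal{A}|=n$). Each $a\in\mathcal{A}$ has a countable set $\mathsf{Var}_a$ of propositional letters; these sets are pairwise disjoint, and $\mathsf{Var}:=\bigcup_{a\in\mathcal{A}}\mathsf{Var}_a$. Kripke models. A doxastic Kripke model is a triple $M=(W,R,V)$ with $W\neq\emptyset$ a set, $R$ assigning to each $a\in\mathcal{A}$ a relation $R_a\subseteq W\times W$, and $V:W\to\mathcal{P}(\mathsf{Var})$. It is serial/transitive/Euclidean if every $R_a$ is (Euclidean: $uR_av$ and $uR_aw$ imply $vR_aw$). For a relation $S$, $S^{\leftrightarrow}:=S\cup S^{ -1}$ is its symmetric closure and $S^{\equiv}$ is the smallest equivalence relation containing $S$. $M$ is proper if for all $u\neq v$ in $W$ there is $a\in\mathcal{A}$ with $(u,v)\notin R_a^{\equiv}$. $M$ is local if for all $a\in\mathcal{A}$, $u,v\in W$: $(u,v)\in R_a^{\leftrightarrow}$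 implies $V(u)\cap\mathsf{Var}_a=V(v)\cap\mathsf{Var}_a$. Hypergraph models. A directed hyperedge over a set $\mathscr{V}$ is a pair $E=(X,Y)$ of finite disjoint (possibly empty) subsets of $\mathscr{V}$; $T(E):=X$ (tail), $H(E):=Y$ (head), $U(E):=T(E)\cup H(E)$. A directed hypergraph is a pair $G=(\mathscr{V}(G),\mathscr{E}(G))$ with $\mathscr{V}(G)$ a non-empty set and $\mathscr{E}(G)$ a set of directed hyperedges over $\mathscr{V}(G)$. $G$ is simple if for all $E_1,E_2\in\mathscr{E}(G)$, $E_1\neq E_2$ implies $U(E_1)\not\subseteq U(E_2)$; $k$-uniform if $|U(E)|=k$ for all $E\in\mathscr{E}(G)$; tail-complete if $\mathscr{V}(G)=\bigcup_{E\in\mathscr{E}(G)}T(E)$. A coloring of $G$ is a map $\chi:\mathscr{V}(G)\to\mathcal{A}$ such that for every $E\in\mathscr{E}(G)$ and all distinct $u,v\in U(E)$, $\chi(u)\neq\chi(v)$. A hypergraph model is a triple $(G,\chi,\ell)$ with $G$ a directed hypergraph, $\chi$ a coloring of $G$, and $\ell:\mathscr{V}(G)\to\mathcal{P}(\mathsf{Var})$ such that $\chi(u)=a$ implies $\ell(u)\subseteq\mathsf{Var}_a$. It is simple ($n$-uniform, tail-complete) if $G$ is. The model $\mathfrak{H}(M)$. Let $M=(W,R,V)$ be a local doxastic Kripke model. For each $(a,u)\in\mathcal{A}\times W$ let $x_u^a$ be a fresh element (distinct for distinct pairs), and let $[x_u^a]$ be its class under the equivalence relation $\{(x_u^a,x_v^a)\mid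 a\in\mathcal{A},(u,v)\in R_a^{\equiv}\}$. For $u\in W$ put $X_u:=\{[x_u^a]\mid a\in\mathcal{A},(u,u)\in R_a\}$ and $Y_u:=\{[x_u^a]\mid a\in\mathcal{A},(u,u)\notin R_a\}$. Then $\mathfrak{H}(M)=(G,\chi,\ell)$ with $\mathscr{V}(G)=\{[x_u^a]\mid a\in\mathcal{A},u\in W\}$, $\mathscr{E}(G)=\{(X_u,Y_u)\mid u\in W\}$, $\chi([x_u^a]):=a$, and $\ell([x_u^a]):=V(u)\cap\mathsf{Var}_a$ (these are well defined). -}

module Defs where

open import Axiom.ExcludedMiddle using (ExcludedMiddle)
open import Data.Fin using (Fin; zero; suc)
open import Data.Fin.Properties using (suc-injective)
open import Data.Nat using (ℕ; zero; suc; _≥_; s≤s)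
open import Data.Product using (Σ; ∃-syntax; _×_; _,_; proj₁; proj₂)
open import Data.Sum using (inj₁; inj₂)
open import Function.Base using (_∘_)
open import Function.Bundles using (_↔_; _↣_; Bijection; Inverse)
open import Level using (Level) renaming (suc to lsuc)
open import Relation.Binary.Bundles using (Setoid)
open import Relation.Binary.Core using (Rel)
open import Relation.Binary.Definitions using (Transitive; _Respects_)
open import Relation.Binary.Structures using (IsEquivalence)
open import Relation.Binary.PropositionalEquality using (_≡_; _≢_; refl; sym; trans; cong; subst)
open import Relation.Nullary using (¬_; Dec; yes; no; contradiction)
open import Relation.Unary using (Pred; _∈_; _∩_; _∪_; _⊆_; _⊈_; _≐_; _⊥_)
import Relation.Binary.Construct.Closure.Equivalence as Equivalence
open import Relation.Binary.Construct.Closure.Equivalence using (EqClosure)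
open import Relation.Binary.Construct.Closure.ReflexiveTransitive using (ε; _◅_)
open import Relation.Binary.Construct.Closure.Symmetric using (SymClosure)
import Relation.Binary.Construct.On as On
import Relation.Binary.PropositionalEquality.Properties as ≡

-- `Letter a` is the set Var_a.  Taking Var to be the disjoint sum of the
-- family makes the subsets Var_a pairwise disjoint by construction.
-- "Countable" includes finite.

record Signature (n : ℕ) (ℓ : Level) : Set (lsuc ℓ) where
  field
    n≥1       : n ≥ 1
    Agent     : Set ℓ
    agents    : Fin n ↔ Agent
    Letter    : Agent → Set ℓ
    countable : ∀ a → Letter a ↣ ℕ

  Var : Set ℓ
  Var = Σ Agent Letter

  Var[_] : Agent → Pred Var ℓ
  Var[ a ] p = proj₁ p ≡ a

module _ {n : ℕ} {ℓ : Level} (S : Signature n ℓ) where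
  open Signature S

  record KripkeModel : Set (lsuc ℓ) where
    field
      W        : Set ℓ
      nonempty : W
      R        : Agent → Rel W ℓ
      V        : W → Pred Var ℓ

module _ {n : ℕ} {ℓ : Level} {S : Signature n ℓ} (M : KripkeModel S) where
  open Signature S
  open KripkeModel M

  Serial : Set ℓ
  Serial = ∀ a u → ∃[ v ] R a u v

  IsTransitive : Set ℓ
  IsTransitive = ∀ a → Transitive (R a)

  Euclidean : Set ℓ
  Euclidean = ∀ a {u v w} → R a u v → R a u w → R a v w

  Proper : Set ℓ
  Proper = ∀ u v → u ≢ v → ∃[ a ] ¬ EqClosure (R a) u v

  Local : Set ℓ
  Local = ∀ a u v → SymClosure (R a) u v → V u ∩ Var[ a ] ≐ V v ∩ Var[ a ]

  record 𝒦ᵗᵉ : Set ℓ where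
    field
      local      : Local
      proper     : Proper
      transitive : IsTransitive
      euclidean  : Euclidean

  record 𝒦ˢᵗᵉ : Set ℓ where
    field
      local      : Local
      proper     : Proper
      serial     : Serial
      transitive : IsTransitive
      euclidean  : Euclidean

-- Vertices form a setoid, so that vertex sets can be quotients.  A subset
-- is a predicate respecting the vertex equality, and its cardinality
-- counts elements up to that equality.

module _ {ℓ : Level} (𝒱 : Setoid ℓ ℓ) where
  open Setoid 𝒱 using (Carrier; _≈_)

  HasCardinality : Pred Carrier ℓ → ℕ → Set ℓ
  HasCardinality X k =
    Bijection (≡.setoid (Fin k)) (On.setoid 𝒱 (proj₁ {B = X}))

  Finite : Pred Carrier ℓ → Set ℓ
  Finite X = ∃[ k ] HasCardinality X k

  record DirectedHyperedge : Set (lsuc ℓ) where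
    field
      T        : Pred Carrier ℓ
      H        : Pred Carrier ℓ
      T-resp   : T Respects _≈_
      H-resp   : H Respects _≈_
      T-finite : Finite T
      H-finite : Finite H
      disjoint : T ⊥ H

    U : Pred Carrier ℓ
    U = T ∪ H

module _ {ℓ : Level} {𝒱 : Setoid ℓ ℓ} where
  open DirectedHyperedge

  infix 4 _≈ᴱ_

  _≈ᴱ_ : Rel (DirectedHyperedge 𝒱) ℓ
  E₁ ≈ᴱ E₂ = (T E₁ ≐ T E₂) × (H E₁ ≐ H E₂)

record DirectedHypergraph (ℓ : Level) : Set (lsuc ℓ) where
  field
    𝒱        : Setoid ℓ ℓ
    nonempty : Setoid.Carrier 𝒱
    ℰ        : Pred (DirectedHyperedge 𝒱) ℓ
    ℰ-resp   : ℰ Respects _≈ᴱ_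

module _ {ℓ : Level} (G : DirectedHypergraph ℓ) where
  open DirectedHypergraph G
  open DirectedHyperedge

  Simple : Set (lsuc ℓ)
  Simple = ∀ E₁ E₂ → E₁ ∈ ℰ → E₂ ∈ ℰ → ¬ (E₁ ≈ᴱ E₂) → U E₁ ⊈ U E₂

  Uniform : ℕ → Set (lsuc ℓ)
  Uniform k = ∀ E → E ∈ ℰ → HasCardinality 𝒱 (U E) k

  TailComplete : Set (lsuc ℓ)
  TailComplete = ∀ x → ∃[ E ] (E ∈ ℰ × x ∈ T E)

module _ {n : ℕ} {ℓ : Level} (S : Signature n ℓ) where
  open Signature S

  record Coloring (G : DirectedHypergraph ℓ) : Set (lsuc ℓ) where
    open DirectedHypergraph G
    open Setoid 𝒱 using (Carrier; _≈_)
    open DirectedHyperedge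
    field
      χ      : Carrier → Agent
      χ-cong : ∀ {x y} → x ≈ y → χ x ≡ χ y
      proper : ∀ E → E ∈ ℰ → ∀ x y → x ∈ U E → y ∈ U E → ¬ (x ≈ y) → χ x ≢ χ y

  record HypergraphModel : Set (lsuc ℓ) where
    field
      G        : DirectedHypergraph ℓ
      coloring : Coloring G
    open DirectedHypergraph G public
    open Coloring coloring public using (χ; χ-cong)
    open Setoid 𝒱 public using (Carrier; _≈_)
    field
      label      : Carrier → Pred Var ℓ
      label-cong : ∀ {x y} → x ≈ y → label x ≐ label y
      label-χ    : ∀ x a → χ x ≡ a → label x ⊆ Var[ a ]

module _ {n : ℕ} {ℓ : Level} {S : Signature n ℓ} (N : HypergraphModel S) where
  open HypergraphModel N using (G)

  record ℋˢᵘ : Set (lsuc ℓ) where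
    field
      simple  : Simple G
      uniform : Uniform G n

  record ℋˢᵘᵗ : Set (lsuc ℓ) where
    field
      simple       : Simple G
      uniform      : Uniform G n
      tailComplete : TailComplete G

record Enumeration {ℓ} {n : ℕ} (P : Pred (Fin n) ℓ) : Set ℓ where
  field
    size      : ℕ
    at        : Fin size → Fin n
    injective : ∀ {i j} → at i ≡ at j → i ≡ j
    sound     : ∀ i → P (at i)
    complete  : ∀ k → P k → ∃[ i ] at i ≡ k

enumerate : ∀ {ℓ} n (P : Pred (Fin n) ℓ) → (∀ i → Dec (P i)) → Enumeration P
enumerate zero P P? = record
  { size = 0 ; at = λ () ; injective = λ { {()} } ; sound = λ () ; complete = λ () }
enumerate (suc n) P P? with P? zero | enumerate n (P ∘ suc) (P? ∘ suc)
... | yes p | e = record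
  { size      = suc E.size
  ; at        = λ { zero → zero ; (suc i) → suc (E.at i) }
  ; injective = λ { {zero} {zero} _ → refl
                  ; {suc i} {suc j} eq → cong suc (E.injective (suc-injective eq)) }
  ; sound     = λ { zero → p ; (suc i) → E.sound i }
  ; complete  = λ { zero _ → zero , refl
                  ; (suc k) q → suc (proj₁ (E.complete k q))
                              , cong suc (proj₂ (E.complete k q)) }
  }
  where module E = Enumeration e
... | no ¬p | e = record
  { size      = E.size
  ; at        = suc ∘ E.at
  ; injective = E.injective ∘ suc-injective
  ; sound     = E.sound
  ; complete  = λ { zero q → contradiction q ¬p
                  ; (suc k) q → proj₁ (E.complete k q)
                              , cong suc (proj₂ (E.complete k q)) }
  }
  where module E = Enumeration e

-- Excluded middle is used only to decide whether (u , u) ∈ R_a, so that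
-- X_u and Y_u are finite sets in the sense of `Finite`.

module Associated {n : ℕ} {ℓ : Level} {S : Signature n ℓ}
                  (em : ExcludedMiddle ℓ) (M : KripkeModel S) (loc : Local M) where
  open Signature S
  open KripkeModel M

  -- The pair (a , u) plays the role of x_u^a.

  Point : Set ℓ
  Point = Agent × W

  infix 4 _∼_

  data _∼_ : Rel Point ℓ where
    ⟨_⟩ : ∀ {a u v} → EqClosure (R a) u v → (a , u) ∼ (a , v)

  ∼-isEquivalence : IsEquivalence _∼_
  ∼-isEquivalence = record
    { refl  = ⟨ ε ⟩
    ; sym   = λ { {_ , _} {_ , _} ⟨ p ⟩ → ⟨ Equivalence.symmetric _ p ⟩ }
    ; trans = λ { {_ , _} {_ , _} {_ , _} ⟨ p ⟩ ⟨ q ⟩ → ⟨ Equivalence.transitive _ p q ⟩ }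
    }

  vertices : Setoid ℓ ℓ
  vertices = record { isEquivalence = ∼-isEquivalence }

  open Setoid vertices using () renaming (refl to ∼-refl; sym to ∼-sym; trans to ∼-trans)

  ∼⇒≡ : ∀ {x y} → x ∼ y → proj₁ x ≡ proj₁ y
  ∼⇒≡ ⟨ _ ⟩ = refl

  -- The set { [x_u^a] | a ∈ P }.

  classes : W → Pred Agent ℓ → Pred Point ℓ
  classes u P y = ∃[ a ] (P a × y ∼ (a , u))

  classes-resp : ∀ u P → classes u P Respects _∼_
  classes-resp u P x∼y (a , p , x∼a) = a , p , ∼-trans (∼-sym x∼y) x∼a

  classes-finite : ∀ u P → Finite vertices (classes u P)
  classes-finite u P = E.size , record
    { to        = λ i → (to (E.at i) , u) , to (E.at i) , E.sound i , ∼-refl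
    ; cong      = λ { refl → ∼-refl }
    ; bijective = (λ eq → E.injective (to-injective (∼⇒≡ eq))) , surjective
    }
    where
    open Inverse agents using (to; from; strictlyInverseˡ; strictlyInverseʳ)
    module E = Enumeration (enumerate n (P ∘ to) (λ i → em))

    to-injective : ∀ {i j} → to i ≡ to j → i ≡ j
    to-injective {i} {j} eq =
      trans (sym (strictlyInverseʳ i)) (trans (cong from eq) (strictlyInverseʳ j))

    surjective : (y : Σ Point (classes u P)) →
                 ∃[ i ] (∀ {j} → j ≡ i → (to (E.at j) , u) ∼ proj₁ y)
    surjective (y , a , p , y∼a)
      with E.complete (from a) (subst P (sym (strictlyInverseˡ a)) p)
    ... | i , eq = i , λ { refl → ∼-sym (subst (λ b → y ∼ (b , u))
                              (sym (trans (cong to eq) (strictlyInverseˡ a))) y∼a) }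

  X : W → Pred Point ℓ
  X u = classes u (λ a → R a u u)

  Y : W → Pred Point ℓ
  Y u = classes u (λ a → ¬ R a u u)

  edge : W → DirectedHyperedge vertices
  edge u = record
    { T        = X u
    ; H        = Y u
    ; T-resp   = classes-resp u _
    ; H-resp   = classes-resp u _
    ; T-finite = classes-finite u _
    ; H-finite = classes-finite u _
    ; disjoint = λ { ((a , r , p) , (b , ¬r , q)) →
        contradiction (subst (λ c → R c u u) (trans (sym (∼⇒≡ p)) (∼⇒≡ q)) r) ¬r }
    }

  hypergraph : DirectedHypergraph ℓ
  hypergraph = record
    { 𝒱        = vertices
    ; nonempty = Inverse.to agents (first n≥1) , nonempty
    ; ℰ        = λ E → ∃[ u ] (E ≈ᴱ edge u)
    ; ℰ-resp   = λ { ((p , p′) , (q , q′)) (u , (s , s′) , (t , t′)) →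
        u , (s ∘ p′ , p ∘ s′) , (t ∘ q′ , q ∘ t′) }
    }
    where
    first : ∀ {m} → m ≥ 1 → Fin m
    first (s≤s _) = zero

  coloring : Coloring S hypergraph
  coloring = record
    { χ      = proj₁
    ; χ-cong = ∼⇒≡
    ; proper = λ { E (u , E≈u) x y x∈E y∈E x≁y eq →
        x≁y (∼-trans (at-u E E≈u x x∈E)
             (subst (λ a → (a , u) ∼ y) (sym eq) (∼-sym (at-u E E≈u y y∈E)))) }
    }
    where
    open DirectedHyperedge

    recolor : ∀ {u} x {a} → x ∼ (a , u) → x ∼ (proj₁ x , u)
    recolor _ ⟨ p ⟩ = ⟨ p ⟩

    at-u : ∀ {u} E → E ≈ᴱ edge u → ∀ x → x ∈ U E → x ∼ (proj₁ x , u)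
    at-u E ((T⊆X , _) , _) x (inj₁ x∈T) = recolor x (proj₂ (proj₂ (T⊆X x∈T)))
    at-u E (_ , (H⊆Y , _)) x (inj₂ x∈H) = recolor x (proj₂ (proj₂ (H⊆Y x∈H)))

  local-closure : ∀ {a u v} → EqClosure (R a) u v → V u ∩ Var[ a ] ≐ V v ∩ Var[ a ]
  local-closure ε = (λ p → p) , (λ p → p)
  local-closure (s ◅ ss) with loc _ _ _ s | local-closure ss
  ... | p , p′ | q , q′ = q ∘ p , p′ ∘ q′

  model : HypergraphModel S
  model = record
    { G          = hypergraph
    ; coloring   = coloring
    ; label      = λ { (a , u) → V u ∩ Var[ a ] }
    ; label-cong = λ { ⟨ p ⟩ → local-closure p }
    ; label-χ    = λ { _ _ refl → proj₂ }
    }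

ℌ : ∀ {n ℓ} {S : Signature n ℓ} → ExcludedMiddle ℓ →
    (M : KripkeModel S) → Local M → HypergraphModel S
ℌ em M loc = Associated.model em M loc

{-# OPTIONS --safe #-}

-- Up to vertex equality, the points of the hyperedge of a world u are exactly
-- the x_u^a, one for each agent a; hence n-uniformity.  An inclusion
-- U(E_u) ⊆ U(E_v) then makes u and v related by every R_a^≡, so properness
-- gives u ≡ v.  For tail-completeness, a successor v of w is reflexive by
-- the Euclidean property, so [x_w^a] = [x_v^a] lies in X_v.

module Submission where

open import Defs
open import Axiom.ExcludedMiddle using (ExcludedMiddle)
open import Data.Nat using (ℕ)
open import Data.Product using (_×_; _,_; proj₁; proj₂)
open import Data.Sum using (inj₁; inj₂)
open import Function.Base using (id)
open import Function.Bundles using (Inverse)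
open import Level using (Level)
open import Relation.Binary.Bundles using (Setoid)
open import Relation.Binary.Construct.Closure.Equivalence using (EqClosure; return)
open import Relation.Binary.PropositionalEquality using (_≡_; refl; sym; trans; cong; subst)
open import Relation.Nullary using (yes; no)
open import Relation.Unary using (_∈_; _⊆_)

module _ {n : ℕ} {ℓ : Level} {S : Signature n ℓ}
         (em : ExcludedMiddle ℓ) (M : KripkeModel S) (loc : Local M) where
  open Signature S
  open KripkeModel M
  open Associated em M loc
  open DirectedHyperedge
  open Setoid vertices using () renaming (refl to ∼-refl; sym to ∼-sym)

  -- Equivalent points carry the same agent, so the representative at `u` can be named by the agent
  -- of `x` alone.
  ∼-recolor : ∀ {x a u} → x ∼ (a , u) → x ∼ (proj₁ x , u)
  ∼-recolor ⟨ p ⟩ = ⟨ p ⟩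

  ∼⇒EqClosure : ∀ {a b u v} → (a , u) ∼ (b , v) → EqClosure (R a) u v
  ∼⇒EqClosure ⟨ p ⟩ = p

  U⇒∼ : ∀ E {u x} → E ≈ᴱ edge u → x ∈ U E → x ∼ (proj₁ x , u)
  U⇒∼ E ((T⊆X , _) , _) (inj₁ x∈T) = ∼-recolor (proj₂ (proj₂ (T⊆X x∈T)))
  U⇒∼ E (_ , (H⊆Y , _)) (inj₂ x∈H) = ∼-recolor (proj₂ (proj₂ (H⊆Y x∈H)))

  ∼⇒U : ∀ E {u x a} → E ≈ᴱ edge u → x ∼ (a , u) → x ∈ U E
  -- Whether `R a u u` holds decides between tail and head; excluded middle makes the two cases
  -- exhaustive.
  ∼⇒U E {u} {a = a} ((_ , X⊆T) , (_ , Y⊆H)) x∼ with em {R a u u}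
  ... | yes r = inj₁ (X⊆T (a , r , x∼))
  ... | no ¬r = inj₂ (Y⊆H (a , ¬r , x∼))

  -- The point `(a , u)` lies in `U E₁`, hence in `U E₂`, where every point with agent `a` is
  -- equivalent to `(a , v)`.
  U⊆⇒EqClosure : ∀ E₁ E₂ {u v} → E₁ ≈ᴱ edge u → E₂ ≈ᴱ edge v →
                 U E₁ ⊆ U E₂ → ∀ a → EqClosure (R a) u v
  U⊆⇒EqClosure E₁ E₂ E₁≈u E₂≈v U⊆ a =
    ∼⇒EqClosure (U⇒∼ E₂ E₂≈v (U⊆ (∼⇒U E₁ {a = a} E₁≈u ∼-refl)))

  -- Membership in `ℰ` is only up to `≈ᴱ`, so two hyperedges of one world have to be compared
  -- through `edge u`.
  ≈ᴱ-joinʳ : ∀ {E₁ E₂ E : DirectedHyperedge vertices} → E₁ ≈ᴱ E → E₂ ≈ᴱ E → E₁ ≈ᴱ E₂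
  ≈ᴱ-joinʳ ((t , t′) , (h , h′)) ((s , s′) , (k , k′)) =
    ((λ x → s′ (t x)) , (λ x → t′ (s x))) , ((λ x → k′ (h x)) , (λ x → h′ (k x)))

  proper⇒simple : Proper M → Simple hypergraph
  proper⇒simple proper E₁ E₂ (u , E₁≈u) (v , E₂≈v) E₁≉E₂ U⊆ with em {u ≡ v}
  ... | yes refl = E₁≉E₂ (≈ᴱ-joinʳ {E₁} {E₂} {edge u} E₁≈u E₂≈v)
  ... | no u≢v with proper u v u≢v
  ...   | a , ¬p = ¬p (U⊆⇒EqClosure E₁ E₂ E₁≈u E₂≈v U⊆ a)

  uniform : Uniform hypergraph n
  uniform E (u , E≈u) = record
    { to        = λ i → (to i , u) , ∼⇒U E E≈u ∼-refl
    ; cong      = λ { refl → ∼-refl }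
    -- Equivalent points have equal agents, which gives injectivity; the index of the agent of `x`
    -- is the preimage of `x`.
    ; bijective = (λ eq → to-injective (∼⇒≡ eq))
                , λ { (x , x∈U) → from (proj₁ x) , λ { refl →
                    ∼-sym (subst (λ a → x ∼ (a , u)) (sym (strictlyInverseˡ (proj₁ x)))
                                 (U⇒∼ E E≈u x∈U)) } }
    }
    where
    open Inverse agents using (to; from; strictlyInverseˡ; strictlyInverseʳ)

    to-injective : ∀ {i j} → to i ≡ to j → i ≡ j
    to-injective {i} {j} eq =
      trans (sym (strictlyInverseʳ i)) (trans (cong from eq) (strictlyInverseʳ j))

  tailComplete : Serial M → Euclidean M → TailComplete hypergraph
  tailComplete serial euclidean (a , w) with serial a w
  -- The hyperedge of `v` is taken, since `w` itself may lack a loop and then `(a , w)` lies in the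
  -- head of `edge w`.
  ... | v , wRv = edge v , (v , (id , id) , (id , id))
                , a , euclidean a wRv wRv , ⟨ return wRv ⟩

proposition3 : ∀ {ℓ : Level} (em : ExcludedMiddle ℓ) (n : ℕ) (S : Signature n ℓ) (M : KripkeModel S) (loc : Local M) →
    (𝒦ᵗᵉ M → ℋˢᵘ (ℌ em M loc)) × (𝒦ˢᵗᵉ M → ℋˢᵘᵗ (ℌ em M loc))
proposition3 em n S M loc =
    (λ K → record
      { simple  = proper⇒simple em M loc (𝒦ᵗᵉ.proper K)
      ; uniform = uniform em M loc
      })
  , (λ K → record
      { simple       = proper⇒simple em M loc (𝒦ˢᵗᵉ.proper K)
      ; uniform      = uniform em M loc
      ; tailComplete = tailComplete em M loc (𝒦ˢᵗᵉ.serial K) (𝒦ˢᵗᵉ.euclidean K)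
      })
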